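{- Let $\Omega$ be a finite variety whose elements are Arf numerical semigroups and let $H'=\bigcap_{H\in\Omega}H$. Then $$\langle\Omega\rangle=\langle\{H'\}\rangle,$$ where $\langle\mathcal{F}\rangle$ denotes the variety generated by a family $\mathcal{F}$ of numerical semigroups.
   Context: $\mathbb{N}$ is the set of non-negative integers. A numerical semigroup is a subset $H\subseteq\mathbb{N}$ that contains $0$, is closed under addition, and has finite complement in $\mathbb{N}$. It is Arf if $2a-b\in H$ for all $a,b\in H$ with $a\ge b$. A nonempty family $\Psi$ of numerical semigroups is a variety if: (1) $S\in\Psi$ and $S\subseteq S'$ with $S'$ a numerical semigroup imply $S'\in\Psi$; and (2) $S,S'\in\Psi$ implies $S\cap S'\in\Psi$. For a family $\mathcal{F}$ of numerical semigroups, $\langle\mathcal{F}\rangle$ is the intersection of all varieties containing $\mathcal{F}$; it is the smallest variety containing $\mathcal{F}$. -}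

module Defs where

open import Level using (0ℓ)
open import Data.Nat using (ℕ; _+_; _*_; _∸_; _≤_)
open import Data.List using (List; _++_)
open import Data.List.Relation.Unary.Any using (Any)
import Data.List.Membership.Propositional as List
open import Data.List.Membership.Propositional.Properties using (∈-++⁺ˡ; ∈-++⁺ʳ; ∈-++⁻)
open import Data.Product using (∃; Σ; _,_; proj₁)
open import Data.Sum using ([_,_]′)
open import Function using (_∘_; _⇔_)
open import Relation.Unary using (Pred; _∈_; _⊆_; _≐_; _∩_; ∁; ⋂; Satisfiable)

-- `cofinite` says that the set is the complement of a finite set (the list of
-- gaps).  Classically this is finiteness of the complement; constructively it
-- implies it, and it also makes membership decidable.
record NumericalSemigroup : Set₁ where
  field
    set      : Pred ℕ 0ℓ
    0∈       : 0 ∈ set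
    +-closed : ∀ {a b} → a ∈ set → b ∈ set → a + b ∈ set
    cofinite : Σ (List ℕ) λ gaps → set ≐ ∁ (List._∈ gaps)

open NumericalSemigroup public using (set)

infix 4 _≋_ _≼_

_≼_ : NumericalSemigroup → NumericalSemigroup → Set
S ≼ T = set S ⊆ set T

-- Numerical semigroups are equal when they are equal as subsets of ℕ; this is
-- coarser than propositional equality of records.
_≋_ : NumericalSemigroup → NumericalSemigroup → Set
S ≋ T = set S ≐ set T

_⊓_ : NumericalSemigroup → NumericalSemigroup → NumericalSemigroup
S ⊓ T = record
  { set      = set S ∩ set T
  ; 0∈       = S.0∈ , T.0∈
  ; +-closed = λ (a∈S , a∈T) (b∈S , b∈T) → S.+-closed a∈S b∈S , T.+-closed a∈T b∈T
  ; cofinite =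
      let gS , (S⊆ , ⊆S) = S.cofinite
          gT , (T⊆ , ⊆T) = T.cofinite
      in gS ++ gT
       , (λ (n∈S , n∈T) → [ S⊆ n∈S , T⊆ n∈T ]′ ∘ ∈-++⁻ gS)
       , (λ n∉ → ⊆S (n∉ ∘ ∈-++⁺ˡ) , ⊆T (n∉ ∘ ∈-++⁺ʳ gS))
  }
  where
  module S = NumericalSemigroup S
  module T = NumericalSemigroup T

-- The truncated subtraction is exact, since b ≤ a ≤ 2a.
Arf : NumericalSemigroup → Set
Arf S = ∀ a b → a ∈ set S → b ∈ set S → b ≤ a → 2 * a ∸ b ∈ set S

Family : Set₁
Family = Pred NumericalSemigroup 0ℓ

-- Singletons and finiteness of families are taken up to _≋_.
｛_｝ : NumericalSemigroup → Family
｛ S ｝ = S ≋_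

Finite : Family → Set₁
Finite Ψ = Σ (List NumericalSemigroup) λ Ss → ∀ T → T ∈ Ψ ⇔ Any (T ≋_) Ss

record IsVariety (Ψ : Family) : Set₁ where
  field
    nonempty : Satisfiable Ψ
    upward   : ∀ {S T} → S ∈ Ψ → S ≼ T → T ∈ Ψ
    ⊓-closed : ∀ {S T} → S ∈ Ψ → T ∈ Ψ → S ⊓ T ∈ Ψ

⟨_⟩ : Family → Pred NumericalSemigroup _
⟨ F ⟩ S = ∀ Ψ → IsVariety Ψ → F ⊆ Ψ → S ∈ Ψ

-- The intersection of all members of a family, as a subset of ℕ.  It lives one
-- universe above the carriers of numerical semigroups.
⋂ᶠ : Family → Pred ℕ _
⋂ᶠ Ψ = ⋂ (∃ Ψ) (set ∘ proj₁)

{-# OPTIONS --safe #-}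
module Submission where

open import Defs
open import Data.List using ([]; _∷_)
open import Data.List.Membership.Propositional using () renaming (_∈_ to _∈ˡ_)
open import Data.List.Relation.Unary.All as All using (All; []; _∷_)
open import Data.List.Relation.Unary.Any as Any using (Any)
open import Data.Product using (Σ-syntax; _×_; _,_; proj₁; proj₂)
open import Function using (_∘_; id; module Equivalence)
open import Relation.Binary.PropositionalEquality using (refl)
open import Relation.Unary using (_∈_; _≐_)

-- A finite variety has a least member: intersecting its finitely many members never leaves it. This
-- member is `H′`. A variety containing `Ω` contains `H′`, and one containing `H′` contains, by
-- upward closure, everything above it, hence `Ω`. So the same varieties contain `Ω` and `｛ H′ ｝`,
-- and the generated families agree.

lowerBound : ∀ {Ψ} → IsVariety Ψ → ∀ {Ss} → All (_∈ Ψ) Ss →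
  Σ[ H ∈ NumericalSemigroup ] (H ∈ Ψ × All (H ≼_) Ss)
-- Any member can seed the fold, since a lower bound inside `Ψ` is wanted, not the greatest one.
lowerBound V [] = let S , S∈Ψ = IsVariety.nonempty V in S , S∈Ψ , []
lowerBound V {S ∷ _} (S∈Ψ ∷ Ss∈Ψ) =
  let H , H∈Ψ , H≼Ss = lowerBound V Ss∈Ψ
  in S ⊓ H , IsVariety.⊓-closed V S∈Ψ H∈Ψ
   , proj₁ ∷ All.map {P = H ≼_} {Q = S ⊓ H ≼_} (λ H≼T → H≼T ∘ proj₂) H≼Ss

minimum : ∀ {Ω} → IsVariety Ω → Finite Ω →
  Σ[ H ∈ NumericalSemigroup ] (H ∈ Ω × (∀ {T} → T ∈ Ω → H ≼ T))
minimum {Ω} V (Ss , enum) =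
  let H , H∈Ω , H≼Ss = lowerBound V (All.tabulate listed)
  in H , H∈Ω , λ {T} T∈Ω → below {H} {T} H≼Ss (Equivalence.to (enum T) T∈Ω)
  where
  listed : ∀ {S} → S ∈ˡ Ss → S ∈ Ω
  -- List membership is propositional while `enum` works up to `_≋_`; reflexivity of `_≋_` bridges
  -- the two.
  listed {S} = Equivalence.from (enum S) ∘ Any.map λ { refl → id , id }

  below : ∀ {H T Ts} → All (H ≼_) Ts → Any (T ≋_) Ts → H ≼ T
  below (H≼S ∷ _) (Any.here (_ , S≼T)) = S≼T ∘ H≼S
  below {H} {T} (_ ∷ H≼Ts) (Any.there T∈Ts) = below {H} {T} H≼Ts T∈Ts

⟨minimum⟩ : ∀ {Ω H} → H ∈ Ω → (∀ {T} → T ∈ Ω → H ≼ T) → ⟨ Ω ⟩ ≐ ⟨ ｛ H ｝ ⟩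
⟨minimum⟩ {Ω} {H} H∈Ω H-min =
    (λ S∈⟨Ω⟩ Ψ V H⊆Ψ → S∈⟨Ω⟩ Ψ V λ {T} T∈Ω →
      IsVariety.upward V {H} {T} (H⊆Ψ {H} (id , id)) (H-min {T} T∈Ω))
  -- The singleton is taken up to `_≋_`, so membership in `Ψ` passes from `H` to `T` by upward
  -- closure.
  , (λ S∈⟨H⟩ Ψ V Ω⊆Ψ → S∈⟨H⟩ Ψ V λ {T} H≋T →
      IsVariety.upward V {H} {T} (Ω⊆Ψ H∈Ω) (proj₁ H≋T))

theorem3p23 : (Ω : Family) → IsVariety Ω → Finite Ω →
    (∀ S → S ∈ Ω → Arf S) →
    Σ[ H′ ∈ NumericalSemigroup ] (set H′ ≐ ⋂ᶠ Ω × ⟨ Ω ⟩ ≐ ⟨ ｛ H′ ｝ ⟩)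
theorem3p23 Ω V fin _ =
  let H , H∈Ω , H-min = minimum V fin
  in H
   -- Minimality gives one inclusion; the other holds because `H` is itself one of the sets
   -- intersected.
   , ((λ n∈H (T , T∈Ω) → H-min {T} T∈Ω n∈H) , (λ n∈⋂ → n∈⋂ (H , H∈Ω)))
   , ⟨minimum⟩ {Ω} {H} H∈Ω (λ {T} → H-min {T})
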